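{- Let $n\ge 1$ and $N=\binom{2n}{n}$. There exists a listing $S_0,S_1,\ldots,S_{N-1}$ of all $n$-element subsets of $\{1,2,\ldots,2n\}$ such that (i) $S_{i+N/2}=\{1,\ldots,2n\}\setminus S_i$ for all $0\le i<N/2$, and (ii) for every $i$ (indices taken modulo $N$), $S_{i+1}=(S_i\setminus\{a\})\cup\{b\}$ for some $a\in S_i$, $b\notin S_i$, such that either every integer strictly between $a$ and $b$ belongs to $S_i$, or no integer strictly between $a$ and $b$ belongs to $S_i$.
   Context: Condition (ii) is the "complementary strong minimal change property": in terms of incidence vectors, consecutive vectors differ in exactly two bit positions, and the bits strictly between these two positions are all $1$ or all $0$. Condition (i) says the code is complementary. -}

module Defs where

open import Data.Nat.Base using (ℕ; _+_; _/_)
import Data.Nat.Base as ℕ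
open import Data.Nat.DivMod using (_mod_)
open import Data.Fin.Base using (Fin; toℕ; _<_)
open import Data.Fin.Properties using (nonZeroIndex)
open import Data.Fin.Subset using (Subset; _∈_; _∉_; _∪_; _-_; ⁅_⁆; ∁; ∣_∣)
open import Data.Product.Base using (∃; ∃₂; _×_)
open import Data.Sum.Base using (_⊎_)
open import Function.Definitions using (Injective)
open import Relation.Binary.PropositionalEquality.Core using (_≡_)

private
  variable
    m N : ℕ

infixl 6 _⊕_

-- Addition modulo N; N is nonzero because Fin N is inhabited by i.
_⊕_ : Fin N → ℕ → Fin N
_⊕_ {N} i k = _mod_ (toℕ i + k) N {{nonZeroIndex i}}

StrictlyBetween : Fin m → Fin m → Fin m → Set
StrictlyBetween a b x = (a < x × x < b) ⊎ (b < x × x < a)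

-- The ground set {1, …, m} is represented by Fin m, with x standing for
-- toℕ x + 1; this relabelling preserves the order.
StrongMinimalChange : Subset m → Subset m → Set
StrongMinimalChange p q = ∃₂ λ a b →
  a ∈ p × b ∉ p × q ≡ (p - a) ∪ ⁅ b ⁆ ×
  ((∀ x → StrictlyBetween a b x → x ∈ p) ⊎
   (∀ x → StrictlyBetween a b x → x ∉ p))

-- Every k-element subset of an m-element set occurs exactly once, and
-- nothing else occurs.
record ListsAllOfSize (k : ℕ) (S : Fin N → Subset m) : Set where
  field
    size       : ∀ i → ∣ S i ∣ ≡ k
    injective  : Injective _≡_ _≡_ S
    exhaustive : ∀ p → ∣ p ∣ ≡ k → ∃ λ i → S i ≡ p

-- The shift by N / 2 does not wrap around here, since toℕ i < N / 2.
Complementary : (Fin N → Subset m) → Set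
Complementary {N} S = ∀ i → toℕ i ℕ.< N / 2 → S (i ⊕ N / 2) ≡ ∁ (S i)

CyclicStrongMinimalChange : (Fin N → Subset m) → Set
CyclicStrongMinimalChange S = ∀ i → StrongMinimalChange (S i) (S (i ⊕ 1))

{-# OPTIONS --safe #-}

-- Write a subset as a bit string. For z + k = n the k-subsets of an n-set are
-- listed from 0^z 1^k to 1^k 0^z by the recursion of Eades and McKay
--   E(z,k) = 0 E(z-1,k),  1 0 reverse(E(z-1,k-1)),  1 1 E(z,k-2),
-- (the third block is absent when k = 1), in which consecutive blocks are joined
-- by a strong minimal change. For the theorem, prefix 1 to the listing with z = n
-- and k = n - 1: this lists the n-subsets that contain the first element, from
-- 1 0^n 1^(n-1) to 1 1^(n-1) 0^n. The complement of the first string is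
-- 0 1^n 0^(n-1), one strong minimal change away from the last one, so the path
-- followed by its complement is a cycle.

module Submission where

open import Defs
open import Data.Nat.Base using (ℕ; _*_; _≤_; zero; suc; _+_; _<_; _/_; s≤s; s<s⁻¹; NonZero)
open import Data.Nat.Properties
  using (suc-injective; +-suc; +-comm; +-identityʳ; *-comm; m+1+n≢0; m≤m+n; m≤n+m; n<1+n; m<n⇒m<1+n;
         ≤-reflexive; ≤-trans; +-monoˡ-<; m≤n⇒m<n∨m≡n)
open import Data.Nat.Combinatorics using (_C_; nCk+nC[k+1]≡[n+1]C[k+1])
open import Data.Nat.DivMod using (_%_; m<n⇒m%n≡m; n%n≡0; m%n<n; m*n/n≡m)
open import Data.Bool.Base using (Bool; true; false; not)
open import Data.Bool.Properties using (not-involutive; ∨-identityʳ)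
open import Data.Fin.Base using (Fin; zero; suc; toℕ; fromℕ<)
import Data.Fin.Base as Fin
open import Data.Fin.Properties using (toℕ-fromℕ<; toℕ<n; nonZeroIndex)
open import Data.Fin.Subset using (Subset; _∈_; _∉_; _∪_; _-_; ⁅_⁆; ∁; ∣_∣)
open import Data.Fin.Subset.Properties using (p─⊥≡p; ∪-identityʳ; drop-there)
open import Data.Vec.Base using ([]; _∷_; here; there)
import Data.Vec.Base as Vec
import Data.Vec.Properties as Vec
open import Data.List.Base using (List; []; _∷_; _++_; map; length; lookup)
open import Data.List.Properties using (map-∘; map-++; length-map; length-++; ++-identityʳ)
import Data.List.Membership.Propositional as List
open import Data.List.Membership.Propositional.Properties
  using (∈-lookup; ∈-map⁺; ∈-map⁻; ∈-++⁺ˡ; ∈-++⁺ʳ; ∈-++⁻)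
open import Data.List.Relation.Unary.Any using (here; index)
open import Data.List.Relation.Unary.Any.Properties using (lookup-index)
import Data.List.Relation.Unary.All as All
open import Data.List.Relation.Unary.AllPairs using ([]; _∷_)
open import Data.List.Relation.Unary.Unique.Propositional using (Unique)
import Data.List.Relation.Unary.Unique.Propositional.Properties as Unique
open import Data.List.Relation.Binary.Permutation.Propositional
open import Data.List.Relation.Binary.Permutation.Propositional.Properties
  using (∈-resp-↭; ↭-length; ++-comm; ∷↭∷ʳ) renaming (map⁺ to ↭-map⁺; ++⁺ to ↭-++⁺)
import Data.List.Relation.Binary.Permutation.Setoid.Properties as ↭ₛ
open import Data.Product.Base using (∃; _×_; _,_)
open import Data.Sum.Base using (_⊎_; inj₁; inj₂)
import Data.Sum.Base as Sum
open import Function.Base using (_∘_)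
open import Level using (0ℓ)
open import Relation.Binary.Core using (Rel)
open import Relation.Binary.Definitions using (Symmetric)
open import Relation.Binary.Construct.Closure.ReflexiveTransitive using (Star; ε; _◅_; _◅◅_; gmap)
open import Relation.Binary.PropositionalEquality
  using (_≡_; _≢_; refl; sym; cong; cong₂; subst; module ≡-Reasoning)
import Relation.Binary.PropositionalEquality as ≡
open import Relation.Nullary.Negation using (contradiction)

private
  variable
    A B : Set
    m n k z : ℕ
    s t c : Bool
    p q : Subset n

-- Walks as lists of vertices

module _ {A : Set} {T : Rel A 0ℓ} where

  private
    variable
      x y x′ y′ : A

  vertices : Star T x y → List A
  vertices {x = x} ε       = x ∷ []
  vertices {x = x} (_ ◅ w) = x ∷ vertices w

  -- The walks are joined by an extra step rather than at a common endpoint, so no entry is merged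
  -- and the vertex lists simply concatenate.
  vertices-◅◅ : (w : Star T x y) (r : T y x′) (w′ : Star T x′ y′) →
                vertices (w ◅◅ r ◅ w′) ≡ vertices w ++ vertices w′
  vertices-◅◅ ε       r w′ = refl
  vertices-◅◅ (_ ◅ w) r w′ = cong (_ ∷_) (vertices-◅◅ w r w′)

  reverse : Symmetric T → Symmetric (Star T)
  reverse sy ε       = ε
  reverse sy (r ◅ w) = reverse sy w ◅◅ sy r ◅ ε

  -- A permutation suffices: enumeration depends only on the multiset of vertices, and the endpoints
  -- stay visible in the type of the walk.
  vertices-reverse : (sy : Symmetric T) (w : Star T x y) →
                     vertices (reverse sy w) ↭ vertices w
  vertices-reverse sy ε       = ↭-refl
  vertices-reverse sy (r ◅ w) =
    ↭-trans (↭-reflexive (vertices-◅◅ (reverse sy w) (sy r) ε))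
   (↭-trans (↭-sym (∷↭∷ʳ _ _))
            (prep _ (vertices-reverse sy w)))

  lookup-first : (w : Star T x y) (i : Fin (length (vertices w))) → toℕ i ≡ 0 →
                 lookup (vertices w) i ≡ x
  lookup-first ε       zero _ = refl
  lookup-first (_ ◅ _) zero _ = refl

  lookup-last : (w : Star T x y) (i : Fin (length (vertices w))) →
                suc (toℕ i) ≡ length (vertices w) → lookup (vertices w) i ≡ y
  lookup-last ε             zero    eq = refl
  lookup-last (_ ◅ ε)       zero    ()
  lookup-last (_ ◅ (_ ◅ _)) zero    ()
  lookup-last (_ ◅ w)       (suc i) eq = lookup-last w i (suc-injective eq)

  lookup-step : (w : Star T x y) (i j : Fin (length (vertices w))) → toℕ j ≡ suc (toℕ i) →
                T (lookup (vertices w) i) (lookup (vertices w) j)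
  lookup-step ε       zero    zero    ()
  lookup-step (r ◅ w) zero    (suc j) eq =
    subst (T _) (sym (lookup-first w j (suc-injective eq))) r
  lookup-step (r ◅ w) (suc i) (suc j) eq = lookup-step w i j (suc-injective eq)

vertices-gmap : {T : Rel A 0ℓ} {U : Rel B 0ℓ} (f : A → B) (g : ∀ {x y} → T x y → U (f x) (f y)) →
                ∀ {x y} (w : Star T x y) → vertices {T = U} (gmap f g w) ≡ map f (vertices w)
vertices-gmap f g ε       = refl
vertices-gmap {U = U} f g (_ ◅ w) = cong (_ ∷_) (vertices-gmap {U = U} f g w)

-- Cyclic indices and lookup in concatenated lists

toℕ-⊕ : ∀ {N} (i : Fin N) k → toℕ (i ⊕ k) ≡ _%_ (toℕ i + k) N {{nonZeroIndex i}}
toℕ-⊕ {N} i k = toℕ-fromℕ< (m%n<n (toℕ i + k) N {{nonZeroIndex i}})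

toℕ-⊕-< : ∀ {N} (i : Fin N) k → toℕ i + k < N → toℕ (i ⊕ k) ≡ toℕ i + k
toℕ-⊕-< i k lt = ≡.trans (toℕ-⊕ i k) (m<n⇒m%n≡m {{nonZeroIndex i}} lt)

lookup-cyclic-step : {T : Rel A 0ℓ} {x y : A} (w : Star T x y) → T y x → (i : Fin (length (vertices w))) →
                     T (lookup (vertices w) i) (lookup (vertices w) (i ⊕ 1))
lookup-cyclic-step {T = T} {x = x} w r i with m≤n⇒m<n∨m≡n (toℕ<n i)
... | inj₁ lt = lookup-step w i (i ⊕ 1)
                  (≡.trans (toℕ-⊕-< i 1 (≤-trans (s≤s (≤-reflexive (+-comm (toℕ i) 1))) lt)) (+-comm (toℕ i) 1))
-- At the last index the shift wraps around to 0, and the closing step `r` is used.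
... | inj₂ eq = ≡.subst₂ T (sym (lookup-last w i eq)) (sym (lookup-first w (i ⊕ 1) i⊕1≡0)) r
  where
  N = length (vertices w)
  instance
    N≢0 : NonZero N
    N≢0 = nonZeroIndex i
  i⊕1≡0 : toℕ (i ⊕ 1) ≡ 0
  i⊕1≡0 = begin
    toℕ (i ⊕ 1)       ≡⟨ toℕ-⊕ i 1 ⟩
    (toℕ i + 1) % N   ≡⟨ cong (_% N) (≡.trans (+-comm (toℕ i) 1) eq) ⟩
    N % N             ≡⟨ n%n≡0 N ⟩
    0                 ∎
    where open ≡-Reasoning

lookup-++ˡ : (xs : List A) {ys : List A} (i : Fin (length xs)) (j : Fin (length (xs ++ ys))) →
             toℕ j ≡ toℕ i → lookup (xs ++ ys) j ≡ lookup xs i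
lookup-++ˡ (_ ∷ xs) zero    zero    eq = refl
lookup-++ˡ (_ ∷ xs) (suc i) (suc j) eq = lookup-++ˡ xs i j (suc-injective eq)

lookup-++ʳ : (xs : List A) {ys : List A} (i : Fin (length ys)) (j : Fin (length (xs ++ ys))) →
             toℕ j ≡ toℕ i + length xs → lookup (xs ++ ys) j ≡ lookup ys i
lookup-++ʳ []       {_ ∷ _}  zero    zero    eq = refl
lookup-++ʳ []       {_ ∷ ys} (suc i) (suc j) eq = lookup-++ʳ [] {ys} i j (suc-injective eq)
lookup-++ʳ (_ ∷ xs) i zero    eq = contradiction (sym eq) (m+1+n≢0 (toℕ i))
lookup-++ʳ (_ ∷ xs) i (suc j) eq = lookup-++ʳ xs i j (suc-injective (≡.trans eq (+-suc (toℕ i) _)))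

lookup-map : (f : A → B) (xs : List A) (i : Fin (length xs)) (j : Fin (length (map f xs))) →
             toℕ j ≡ toℕ i → lookup (map f xs) j ≡ f (lookup xs i)
lookup-map f (_ ∷ xs) zero    zero    eq = refl
lookup-map f (_ ∷ xs) (suc i) (suc j) eq = lookup-map f xs i j (suc-injective eq)

Unique⇒lookup-injective : {xs : List A} → Unique xs → ∀ i j → lookup xs i ≡ lookup xs j → i ≡ j
Unique⇒lookup-injective (_ ∷ _)  zero    zero    eq = refl
Unique⇒lookup-injective (x∉ ∷ _) zero    (suc j) eq = contradiction eq (All.lookup x∉ (∈-lookup j))
Unique⇒lookup-injective (x∉ ∷ _) (suc i) zero    eq =
  contradiction (sym eq) (All.lookup x∉ (∈-lookup i))
Unique⇒lookup-injective (_ ∷ u)  (suc i) (suc j) eq = cong suc (Unique⇒lookup-injective u i j eq)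

-- The concatenation is twice as long as `xs`, so the shift by half its length carries an index of
-- the first half to the same position in the second.
complementary : (xs : List (Subset m)) → Complementary (lookup (xs ++ map ∁ xs))
complementary xs i i<half = begin
  lookup ys (i ⊕ length ys / 2)   ≡⟨ lookup-++ʳ xs i″ (i ⊕ length ys / 2) i⊕half ⟩
  lookup (map ∁ xs) i″            ≡⟨ lookup-map ∁ xs i′ i″ (≡.trans (toℕ-fromℕ< _) (sym toℕ-i′)) ⟩
  ∁ (lookup xs i′)                ≡⟨ cong ∁ (lookup-++ˡ xs i′ i (sym toℕ-i′)) ⟨
  ∁ (lookup ys i)                 ∎
  where
  open ≡-Reasoning
  ys = xs ++ map ∁ xs
  len : length ys ≡ length xs + length xs
  len = ≡.trans (length-++ xs) (cong (length xs +_) (length-map ∁ xs))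
  half : length ys / 2 ≡ length xs
  half = begin
    length ys / 2                 ≡⟨ cong (_/ 2) len ⟩
    (length xs + length xs) / 2   ≡⟨ cong (λ l → (length xs + l) / 2) (+-identityʳ (length xs)) ⟨
    2 * length xs / 2             ≡⟨ cong (_/ 2) (*-comm 2 (length xs)) ⟩
    length xs * 2 / 2             ≡⟨ m*n/n≡m (length xs) 2 ⟩
    length xs                     ∎
  i<len : toℕ i < length xs
  i<len = subst (toℕ i <_) half i<half
  i′ : Fin (length xs)
  i′ = fromℕ< i<len
  toℕ-i′ : toℕ i′ ≡ toℕ i
  toℕ-i′ = toℕ-fromℕ< i<len
  i″ : Fin (length (map ∁ xs))
  i″ = fromℕ< (subst (toℕ i <_) (sym (length-map ∁ xs)) i<len)
  i⊕half : toℕ (i ⊕ length ys / 2) ≡ toℕ i″ + length xs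
  i⊕half = begin
    toℕ (i ⊕ length ys / 2)   ≡⟨ cong (λ h → toℕ (i ⊕ h)) half ⟩
    toℕ (i ⊕ length xs)       ≡⟨ toℕ-⊕-< i (length xs) (subst (toℕ i + length xs <_) (sym len) (+-monoˡ-< (length xs) i<len)) ⟩
    toℕ i + length xs         ≡⟨ cong (_+ length xs) (toℕ-fromℕ< _) ⟨
    toℕ i″ + length xs        ∎

-- Strong minimal changes as an inductive relation

-- The tail of a strong minimal change whose first changed bit goes from s to t:
-- the bits c lie strictly between the two changed positions.
data Slide (c s t : Bool) : Subset n → Subset n → Set where
  here  : Slide c s t (t ∷ p) (s ∷ p)
  there : Slide c s t p q → Slide c s t (c ∷ p) (c ∷ q)

-- `skip` passes the common prefix, `slide` makes the first change and its `Slide` locates the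
-- second. In this form symmetry, prefixing and complementation need no arithmetic on positions.
data Move : Subset n → Subset n → Set where
  skip  : Move p q → Move (s ∷ p) (s ∷ q)
  slide : ∀ {n} {p q : Subset n} → s ≢ t → Slide c s t p q → Move (s ∷ p) (t ∷ q)

Slide-sym : Slide c s t p q → Slide c t s q p
Slide-sym here      = here
Slide-sym (there r) = there (Slide-sym r)

Move-sym : Move p q → Move q p
Move-sym (skip r)      = skip (Move-sym r)
Move-sym (slide s≢t r) = slide (s≢t ∘ sym) (Slide-sym r)

-- Complementing also flips the intermediate bits; the result is again a slide because `c` may be
-- either bit.
Slide-∁ : Slide c s t p q → Slide (not c) (not s) (not t) (∁ p) (∁ q)
Slide-∁ here      = here
Slide-∁ (there r) = there (Slide-∁ r)

not-injective : not s ≡ not t → s ≡ t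
not-injective {s} {t} eq =
  ≡.trans (sym (not-involutive s)) (≡.trans (cong not eq) (not-involutive t))

Move-∁ : Move p q → Move (∁ p) (∁ q)
Move-∁ (skip r)      = skip (Move-∁ r)
Move-∁ (slide s≢t r) = slide (s≢t ∘ not-injective) (Slide-∁ r)

-- The first changed bit, which precedes `p`, is switched off, so the tail gains an element `j`; the
-- bits of `p` before `j` are those strictly between the two changes.
Slide-insert : Slide c true false p q →
  ∃ λ j → j ∉ p × q ≡ p ∪ ⁅ j ⁆ × (∀ x → x Fin.< j → Vec.lookup p x ≡ c)
Slide-insert {p = _ ∷ p} here = zero , (λ ()) , cong (true ∷_) (sym (∪-identityʳ p)) , λ _ ()
Slide-insert {c = c} (there r) with j , j∉p , eq , before ← Slide-insert r =
  suc j , j∉p ∘ drop-there , cong₂ _∷_ (sym (∨-identityʳ c)) eq ,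
  λ { zero _ → refl ; (suc x) lt → before x (s<s⁻¹ lt) }

Slide-delete : Slide c false true p q →
  ∃ λ j → j ∈ p × q ≡ p - j × (∀ x → x Fin.< j → Vec.lookup p x ≡ c)
Slide-delete {p = _ ∷ p} here = zero , here , cong (false ∷_) (sym (p─⊥≡p p)) , λ _ ()
Slide-delete (there r) with j , j∈p , eq , before ← Slide-delete r =
  suc j , there j∈p , cong (_ ∷_) eq ,
  λ { zero _ → refl ; (suc x) lt → before x (s<s⁻¹ lt) }

lookup-constant : {P : Fin n → Set} (p : Subset n) (c : Bool) →
                  (∀ x → P x → Vec.lookup p x ≡ c) →
                  (∀ x → P x → x ∈ p) ⊎ (∀ x → P x → x ∉ p)
lookup-constant p true  h = inj₁ λ x px → Vec.lookup⇒[]= x p (h x px)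
lookup-constant p false h = inj₂ λ x px x∈p →
  contradiction (≡.trans (sym (h x px)) (Vec.[]=⇒lookup x∈p)) λ ()

-- The position switched off is `a` and the one switched on is `b`, so which of them comes first
-- depends on the direction of the first change.
Move⇒StrongMinimalChange : Move p q → StrongMinimalChange p q
Move⇒StrongMinimalChange (skip {s = s} r)
  with a , b , a∈p , b∉p , eq , between ← Move⇒StrongMinimalChange r =
  suc a , suc b , there a∈p , b∉p ∘ drop-there ,
  cong₂ _∷_ (sym (∨-identityʳ s)) eq ,
  -- Both positions move up by one, so the new position `zero` precedes both and is never between
  -- them.
  Sum.map (λ h → λ { zero (inj₁ ()) ; zero (inj₂ ())
                   ; (suc x) bt → there (h x (Sum.map pred pred bt)) })
          (λ h → λ { zero (inj₁ ()) ; zero (inj₂ ())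
                   ; (suc x) bt → h x (Sum.map pred pred bt) ∘ drop-there })
          between
  where
  pred : ∀ {a b c d} → suc a < suc b × suc c < suc d → a < b × c < d
  pred (lt , lt′) = s<s⁻¹ lt , s<s⁻¹ lt′
Move⇒StrongMinimalChange (slide {false} {false} s≢t r) = contradiction refl s≢t
Move⇒StrongMinimalChange (slide {true}  {true}  s≢t r) = contradiction refl s≢t
Move⇒StrongMinimalChange (slide {true} {false} {c} {p = p} s≢t r)
  with j , j∉p , eq , before ← Slide-insert r =
  zero , suc j , here , j∉p ∘ drop-there ,
  cong (false ∷_) (≡.trans eq (cong (_∪ ⁅ j ⁆) (sym (p─⊥≡p p)))) ,
  lookup-constant (true ∷ p) c
    λ { zero (inj₁ (() , _)) ; zero (inj₂ (_ , ())) ; (suc x) (inj₁ (_ , lt)) → before x (s<s⁻¹ lt)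
      ; (suc x) (inj₂ (_ , ())) }
Move⇒StrongMinimalChange (slide {false} {true} {c} {p = p} s≢t r)
  with j , j∈p , eq , before ← Slide-delete r =
  suc j , zero , there j∈p , (λ ()) ,
  cong (true ∷_) (≡.trans eq (sym (∪-identityʳ (p - j)))) ,
  lookup-constant (false ∷ p) c
    λ { zero (inj₁ (() , _)) ; zero (inj₂ (() , _)) ; (suc x) (inj₂ (_ , lt)) → before x (s<s⁻¹ lt)
      ; (suc x) (inj₁ (_ , ())) }

-- Subsets of fixed size

-- A reference enumeration by Pascal's rule. Its order is irrelevant: size, uniqueness and
-- exhaustiveness are proved for it and carried over to any permutation.
combinations : ∀ n → ℕ → List (Subset n)
combinations zero    zero    = [] ∷ []
combinations zero    (suc k) = []
combinations (suc n) zero    = map (false ∷_) (combinations n zero)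
combinations (suc n) (suc k) =
  map (true ∷_) (combinations n k) ++ map (false ∷_) (combinations n (suc k))

length-combinations : ∀ n k → length (combinations n k) ≡ n C k
length-combinations zero    zero    = refl
length-combinations zero    (suc k) = refl
length-combinations (suc n) zero    =
  ≡.trans (length-map _ (combinations n 0)) (length-combinations n 0)
length-combinations (suc n) (suc k) = begin
  length (combinations (suc n) (suc k))
    ≡⟨ length-++ (map (true ∷_) (combinations n k)) ⟩
  length (map (true ∷_) (combinations n k)) + length (map (false ∷_) (combinations n (suc k)))
    ≡⟨ cong₂ _+_ (length-map _ (combinations n k)) (length-map _ (combinations n (suc k))) ⟩
  length (combinations n k) + length (combinations n (suc k))
    ≡⟨ cong₂ _+_ (length-combinations n k) (length-combinations n (suc k)) ⟩
  n C k + n C suc k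
    ≡⟨ nCk+nC[k+1]≡[n+1]C[k+1] n k ⟩
  suc n C suc k ∎
  where open ≡-Reasoning

combinations-unique : ∀ n k → Unique (combinations n k)
combinations-unique zero    zero    = All.[] ∷ []
combinations-unique zero    (suc k) = []
combinations-unique (suc n) zero    = Unique.map⁺ Vec.∷-injectiveʳ (combinations-unique n zero)
combinations-unique (suc n) (suc k) =
  Unique.++⁺ (Unique.map⁺ Vec.∷-injectiveʳ (combinations-unique n k))
             (Unique.map⁺ Vec.∷-injectiveʳ (combinations-unique n (suc k)))
             disjoint
  where
  disjoint : ∀ {p} → p List.∈ map (true ∷_) (combinations n k) ×
                     p List.∈ map (false ∷_) (combinations n (suc k)) → _
  disjoint (p∈ , p∈′) with _ , _ , refl ← ∈-map⁻ _ p∈ with () ← ∈-map⁻ _ p∈′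

∈-combinations⁻ : ∀ n k {p} → p List.∈ combinations n k → ∣ p ∣ ≡ k
∈-combinations⁻ zero    zero    (here refl) = refl
∈-combinations⁻ (suc n) zero    p∈ with _ , q∈ , refl ← ∈-map⁻ _ p∈ = ∈-combinations⁻ n zero q∈
∈-combinations⁻ (suc n) (suc k) p∈ with ∈-++⁻ (map (true ∷_) (combinations n k)) p∈
... | inj₁ p∈ˡ with _ , q∈ , refl ← ∈-map⁻ _ p∈ˡ = cong suc (∈-combinations⁻ n k q∈)
... | inj₂ p∈ʳ with _ , q∈ , refl ← ∈-map⁻ _ p∈ʳ = ∈-combinations⁻ n (suc k) q∈

∈-combinations⁺ : (p : Subset n) → p List.∈ combinations n ∣ p ∣
∈-combinations⁺ []          = here refl
∈-combinations⁺ (true  ∷ p) = ∈-++⁺ˡ (∈-map⁺ _ (∈-combinations⁺ p))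
∈-combinations⁺ (false ∷ p) = false∷-∈ ∣ p ∣ (∈-combinations⁺ p)
  where
  false∷-∈ : ∀ k → p List.∈ combinations _ k → false ∷ p List.∈ combinations _ k
  false∷-∈ zero    p∈ = ∈-map⁺ _ p∈
  false∷-∈ (suc k) p∈ = ∈-++⁺ʳ _ (∈-map⁺ _ p∈)

combinations-empty : n < k → combinations n k ≡ []
combinations-empty {zero}  {suc k} _   = refl
combinations-empty {suc n} {suc k} n<k =
  cong₂ (λ xs ys → map (true ∷_) xs ++ map (false ∷_) ys)
        (combinations-empty (s<s⁻¹ n<k)) (combinations-empty (m<n⇒m<1+n (s<s⁻¹ n<k)))

-- No subset of an `n`-element set has `suc n` elements, so the half of Pascal's rule with leading
-- `false` is empty.
combinations-full : k ≡ n → combinations (suc n) (suc k) ≡ map (true ∷_) (combinations n k)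
combinations-full {n = n} refl =
  ≡.trans (cong (λ xs → map (true ∷_) (combinations n n) ++ map (false ∷_) xs)
                (combinations-empty (n<1+n n)))
          (++-identityʳ _)

map-∁-∷ : ∀ s (xs : List (Subset n)) → map ∁ (map (s ∷_) xs) ≡ map (not s ∷_) (map ∁ xs)
map-∁-∷ s xs = ≡.trans (sym (map-∘ xs)) (map-∘ xs)

map-∁-∷-↭ : ∀ s {xs ys : List (Subset n)} → map ∁ xs ↭ ys →
            map ∁ (map (s ∷_) xs) ↭ map (not s ∷_) ys
map-∁-∷-↭ s h = ↭-trans (↭-reflexive (map-∁-∷ s _)) (↭-map⁺ _ h)

-- Complementation flips the first bit and so exchanges the two halves of Pascal's rule, whence the
-- `++-comm`. If one size is zero and the ground set is nonempty, each side has a single half,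
-- exposed by `combinations-full`.
map-∁-combinations : ∀ n k l → k + l ≡ n → map ∁ (combinations n k) ↭ combinations n l
map-∁-combinations zero    zero    zero    refl = ↭-refl
map-∁-combinations (suc n) zero    (suc l) refl =
  ↭-trans (map-∁-∷-↭ false (map-∁-combinations n zero n refl))
          (↭-reflexive (sym (combinations-full refl)))
map-∁-combinations (suc n) (suc k) zero    eq with refl ← ≡.trans (sym (+-identityʳ k)) (suc-injective eq) =
  ↭-trans (↭-reflexive (cong (map ∁) (combinations-full refl)))
          (map-∁-∷-↭ true (map-∁-combinations n n zero (+-identityʳ n)))
map-∁-combinations (suc n) (suc k) (suc l) eq =
  ↭-trans (↭-reflexive (map-++ ∁ (map (true ∷_) (combinations n k)) _))
 (↭-trans (++-comm (map ∁ (map (true ∷_) (combinations n k))) _)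
          (↭-++⁺ (map-∁-∷-↭ false (map-∁-combinations n (suc k) l (≡.trans (sym (+-suc k l)) (suc-injective eq))))
                 (map-∁-∷-↭ true (map-∁-combinations n k (suc l) (suc-injective eq)))))

-- All three properties are invariant under permutation.
listsAllOfSize : {xs : List (Subset n)} → xs ↭ combinations n k → ListsAllOfSize k (lookup xs)
listsAllOfSize {n} {k} {xs} xs↭ = record
  { size       = λ i → ∈-combinations⁻ n k (∈-resp-↭ xs↭ (∈-lookup i))
  ; injective  = λ {i} {j} → Unique⇒lookup-injective unique i j
  ; exhaustive = λ { p refl → let p∈ = ∈-resp-↭ (↭-sym xs↭) (∈-combinations⁺ p)
                              in index p∈ , sym (lookup-index p∈) }
  }
  where
  unique : Unique xs
  unique = ↭ₛ.Unique-resp-↭ (≡.setoid _) (↭⇒↭ₛ (↭-sym xs↭)) (combinations-unique n k)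

-- The Eades–McKay path

-- The string s^k (not s)^(n-k), for k ≤ n.
block : Bool → ℕ → Subset n
block {zero}  s k       = []
block {suc n} s zero    = not s ∷ block s zero
block {suc n} s (suc k) = s ∷ block s k

-- The first `k` bits, all equal to `s`, form the run between the two changes. This supplies both
-- kinds of long move: `r₁` with zeros between and `turn` with ones between.
Slide-block : ∀ s k → k < n → Slide s s (not s) (block {n} s k) (block s (suc k))
Slide-block {suc n} s zero    _   = here
Slide-block {suc n} s (suc k) k<n = there (Slide-block s k (s<s⁻¹ k<n))

∁-block : ∀ s k → ∁ (block {n} s k) ≡ block (not s) k
∁-block {zero}  s k       = refl
∁-block {suc n} s zero    = cong (not (not s) ∷_) (∁-block s zero)
∁-block {suc n} s (suc k) = cong (not s ∷_) (∁-block s k)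

-- The all-zero string has two descriptions, as the start and as the end of a path through the empty
-- set alone.
block-all : ∀ k → k ≡ n → block {n} false k ≡ block true 0
block-all zero    refl = refl
block-all (suc k) refl = cong (false ∷_) (block-all k refl)

vertices-skip : ∀ s {xs} (w : Star Move p q) → vertices w ↭ xs →
                vertices (gmap {U = Move} (s ∷_) skip w) ↭ map (s ∷_) xs
vertices-skip s w h =
  ↭-trans (↭-reflexive (vertices-gmap {U = Move} (s ∷_) skip w)) (↭-map⁺ _ h)

-- Fixing the endpoints in the type is what lets blocks be joined. For `z + k ≡ n` they are the
-- strings 0^z 1^k and 1^k 0^z.
record GrayPath (n z k : ℕ) : Set where
  field
    walk      : Star Move (block {n} false z) (block true k)
    vertices↭ : vertices walk ↭ combinations n k

open GrayPath

false≢true : false ≢ true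
false≢true ()

grayPath-zeros : GrayPath n z 0 → GrayPath (suc n) (suc z) 0
grayPath-zeros g = record
  { walk      = gmap (false ∷_) skip (walk g)
  ; vertices↭ = vertices-skip false (walk g) (vertices↭ g)
  }

grayPath-ones : k ≡ n → GrayPath n 0 k → GrayPath (suc n) 0 (suc k)
grayPath-ones k≡n g = record
  { walk      = gmap (true ∷_) skip (walk g)
  ; vertices↭ = ↭-trans (vertices-skip true (walk g) (vertices↭ g))
                        (↭-reflexive (sym (combinations-full k≡n)))
  }

-- After a leading 1 only zeros remain, so the 11 block is absent and the 10 block is a single
-- string, which needs no reversal.
grayPath-singletons : z ≡ n → GrayPath (suc n) z 1 → GrayPath n z 0 →
                      GrayPath (suc (suc n)) (suc z) 1
grayPath-singletons {z} z≡n g₀ g₁ = record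
  { walk      = w₀ ◅◅ r₀ ◅ w₁
  ; vertices↭ =
      ↭-trans (↭-reflexive (vertices-◅◅ w₀ r₀ w₁))
     (↭-trans (++-comm (vertices w₀) (vertices w₁))
              (↭-++⁺ (vertices-skip true _ (vertices-skip false _ (vertices↭ g₁)))
                     (vertices-skip false _ (vertices↭ g₀))))
  }
  where
  w₀ = gmap {U = Move} (false ∷_) skip (walk g₀)
  w₁ = gmap {U = Move} (true ∷_) skip (gmap {U = Move} (false ∷_) skip (walk g₁))
  r₀ : Move (false ∷ true ∷ block true 0) (true ∷ false ∷ block false z)
  r₀ = subst (λ p → Move (false ∷ true ∷ block true 0) (true ∷ false ∷ p))
             (sym (block-all z z≡n))
             (slide {c = false} false≢true here)

grayPath-step : z < n → GrayPath (suc n) z (suc (suc k)) → GrayPath n z (suc k) →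
                GrayPath n (suc z) k → GrayPath (suc (suc n)) (suc z) (suc (suc k))
grayPath-step {z} {n} {k} z<n g₀ g₁ g₂ = record
  { walk      = w₀ ◅◅ r₀ ◅ w₁ ◅◅ r₁ ◅ w₂
  ; vertices↭ =
      ↭-trans (↭-reflexive (≡.trans (vertices-◅◅ w₀ r₀ (w₁ ◅◅ r₁ ◅ w₂))
                                    (cong (vertices w₀ ++_) (vertices-◅◅ w₁ r₁ w₂))))
     -- The walk visits the blocks 0, 10, 11, while `combinations` lists 11, 10, 0; two swaps
     -- reconcile the orders.
     (↭-trans (++-comm (vertices w₀) _)
              (↭-++⁺ (↭-trans (++-comm (vertices w₁) (vertices w₂))
                     (↭-trans (↭-++⁺ (vertices-skip true _ (vertices-skip true _ (vertices↭ g₂)))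
                                     (vertices-skip true _ (vertices-skip false _
                                       (↭-trans (vertices-reverse Move-sym (walk g₁)) (vertices↭ g₁)))))
                              (↭-reflexive (sym (map-++ (true ∷_) (map (true ∷_) (combinations n k)) _)))))
                     (vertices-skip false _ (vertices↭ g₀))))
  }
  where
  w₀ = gmap {U = Move} (false ∷_) skip (walk g₀)
  -- Reversed, this block starts with 1 0 followed by `block true (suc k)`, which differs from the
  -- end of `w₀` in the first two bits only.
  w₁ = gmap {U = Move} (true ∷_) skip (gmap {U = Move} (false ∷_) skip (reverse Move-sym (walk g₁)))
  w₂ = gmap {U = Move} (true ∷_) skip (gmap {U = Move} (true ∷_) skip (walk g₂))
  r₀ = slide {c = false} false≢true here
  -- The leading 1 stays; the second bit becomes 1 and the 1 found after `z` further zeros becomes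
  -- 0. That position exists by `z<n`.
  r₁ = skip (slide false≢true (Slide-block false z z<n))

grayPath : ∀ n z k → z + k ≡ n → GrayPath n z k
grayPath zero          zero    zero          _  = record { walk = ε ; vertices↭ = ↭-refl }
grayPath (suc n)       (suc z) zero          eq = grayPath-zeros (grayPath n z 0 (suc-injective eq))
grayPath (suc n)       zero    (suc k)       eq =
  grayPath-ones (suc-injective eq) (grayPath n 0 k (suc-injective eq))
-- A string of length one cannot contain both a 0 and a 1.
grayPath (suc zero)    (suc z) (suc k)       eq = contradiction (suc-injective eq) (m+1+n≢0 z)
grayPath (suc (suc n)) (suc z) (suc zero)    eq =
  grayPath-singletons (≡.trans (sym (+-identityʳ z)) z+0≡n)
    (grayPath (suc n) z 1 (suc-injective eq)) (grayPath n z 0 z+0≡n)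
  where
  z+0≡n : z + 0 ≡ n
  z+0≡n = suc-injective (≡.trans (sym (+-suc z 0)) (suc-injective eq))
grayPath (suc (suc n)) (suc z) (suc (suc k)) eq =
  grayPath-step (≤-trans (m≤m+n (suc z) k) (≤-reflexive 1+z+k≡n))
    (grayPath (suc n) z (suc (suc k)) (suc-injective eq))
    (grayPath n z (suc k) z+1+k≡n)
    (grayPath n (suc z) k 1+z+k≡n)
  where
  z+1+k≡n : z + suc k ≡ n
  z+1+k≡n = suc-injective (≡.trans (sym (+-suc z (suc k))) (suc-injective eq))
  1+z+k≡n : suc z + k ≡ n
  1+z+k≡n = ≡.trans (sym (+-suc z k)) z+1+k≡n

-- Closing the path into a cyclic listing

cyclicListing : ∀ {N} (xs : List (Subset m)) → length (xs ++ map ∁ xs) ≡ N →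
                xs ++ map ∁ xs ↭ combinations m k →
                CyclicStrongMinimalChange (lookup (xs ++ map ∁ xs)) →
                ∃ λ (S : Fin N → Subset m) →
                ListsAllOfSize k S × Complementary S × CyclicStrongMinimalChange S
-- Matching on `refl` is possible because `N` is a variable here; for the binomial coefficient
-- itself it would not unify.
cyclicListing xs refl xs↭ cyclic =
  lookup (xs ++ map ∁ xs) , listsAllOfSize xs↭ , complementary xs , cyclic

theorem6 : (n : ℕ) → 1 ≤ n →
    ∃ λ (S : Fin ((2 * n) C n) → Subset (2 * n)) →
    ListsAllOfSize n S × Complementary S × CyclicStrongMinimalChange S
theorem6 (suc n) _ =
  cyclicListing (vertices path)
    (≡.trans (↭-length all) (length-combinations (2 * suc n) (suc n)))
    all
    (subst (CyclicStrongMinimalChange ∘ lookup) vertices-cycle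
      (Move⇒StrongMinimalChange ∘ lookup-cyclic-step cycle close))
  where
  -- `2 * suc n` reduces to `suc l`, so `l` is the length left after the fixed leading bit.
  l = n + suc (n + 0)

  n+1+n≡l : n + suc n ≡ l
  n+1+n≡l = cong (λ m → n + suc m) (sym (+-identityʳ n))

  g = grayPath l (suc n) n (≡.trans (sym (+-suc n n)) n+1+n≡l)

  path : Star Move (true ∷ block false (suc n)) (true ∷ block true n)
  path = gmap (true ∷_) skip (walk g)

  path↭ : vertices path ↭ map (true ∷_) (combinations l n)
  path↭ = vertices-skip true (walk g) (vertices↭ g)

  -- From 1 1^n 0^(n+1) to 0 1^(n+1) 0^n: the `n` ones after the leading bit lie strictly between
  -- the two changes.
  turn : Move (true ∷ block {l} true n) (false ∷ ∁ (block false (suc n)))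
  turn = subst (λ p → Move (true ∷ block true n) (false ∷ p)) (sym (∁-block false (suc n)))
    (slide (false≢true ∘ sym)
      (Slide-block true n (≤-trans (m≤n+m (suc n) n) (≤-reflexive n+1+n≡l))))

  copath : Star Move (∁ (true ∷ block {l} false (suc n))) (∁ (true ∷ block {l} true n))
  copath = gmap ∁ Move-∁ path

  cycle : Star Move (true ∷ block {l} false (suc n)) (∁ (true ∷ block {l} true n))
  cycle = path ◅◅ turn ◅ copath

  close : Move (∁ (true ∷ block {l} true n)) (true ∷ block {l} false (suc n))
  -- The closing move is the complement of `turn`, once the double complement is cancelled.
  close = subst (Move _) (cong (true ∷_) ∁∁-block) (Move-∁ turn)
    where
    ∁∁-block : ∁ (∁ (block {l} false (suc n))) ≡ block false (suc n)
    ∁∁-block = ≡.trans (cong ∁ (∁-block false (suc n))) (∁-block true (suc n))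

  vertices-cycle : vertices cycle ≡ vertices path ++ map ∁ (vertices path)
  vertices-cycle = ≡.trans (vertices-◅◅ path turn copath)
    (cong (vertices path ++_) (vertices-gmap {U = Move} ∁ Move-∁ path))

  all : vertices path ++ map ∁ (vertices path) ↭ combinations (2 * suc n) (suc n)
  -- The path covers the half of Pascal's rule with leading 1; its complements have leading 0 and
  -- `suc n` ones among the other `l` bits, which is the other half.
  all = ↭-++⁺ path↭
    (↭-trans (↭-map⁺ ∁ path↭) (map-∁-∷-↭ true (map-∁-combinations l n (suc n) n+1+n≡l)))
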